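{- For every term $M$ of the Functional Machine Calculus the following are equivalent: 1. $M$ is weakly typeable, i.e. there are a typing context $\Gamma$ and a computation type $\tau$ with $\Gamma\vdash_{w} M:\tau$; 2. $M$ is spine-normalizing; 3. $M$ is machine-terminating: there are memories $S_A$, $T_A$ and a substitution map $\sigma$ such that $S_A,\ \sigma M\Downarrow T_A$.
   Context: **Terms.** Fix a finite set $A$ of locations containing a default location $\lambda$, and infinitely many variables. Terms: $M,N,P ::= x \mid a\langle x\rangle.M \mid [N]a.M \mid \star \mid M;N$ (variable; abstraction/pop on $a\in A$, binding $x$ in $M$; application/push of $N$ on $a\in A$; unit; sequencing), taken up to $\alpha$-equivalence. $\{N/x\}M$ is capture-avoiding substitution, $\mathrm{fv}(N)$ the set of free variables. A substitution map $\sigma$ is a finite function from variables to terms, applied as a simultaneous capture-avoiding substitution $\sigma M$. **Memories.** A stack is a finite sequence of terms, with head (top) on the right; a memory $S_A=\{S_a\mid a\in A\}$ is a family of stacks; $S_A\cdot N_a$ is $S_A$ with $N$ pushed on top of stack $a$. **Evaluation.** $S_A,M\Downarrow_n T_A$ is defined inductively: $S_A,\star\Downarrow_1 S_A$; if $R_A,M\Downarrow_m S_A$ and $S_A,N\Downarrow_n T_A$ then $R_A,(M;N)\Downarrow_{m+n+1}T_A$; if $S_A\cdot N_a,\,M\Downarrow_n T_A$ then $S_A,\,[N]a.M\Downarrow_{n+1}T_A$; if $S_A,\,\{N/x\}M\Downarrow_n T_A$ then $S_A\cdot N_a,\ a\langle x\rangle.M\Downarrow_{n+1}T_A$. Write $S_A,M\Downarrow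 T_A$ if this holds for some $n$. **Spine reduction.** Reduction rules: (beta) $[N]a.a\langle x\rangle.M\to\{N/x\}M$; (passage) $[N]b.a\langle x\rangle.M\to a\langle x\rangle.[N]b.M$ if $a\ne b$, $x\notin\mathrm{fv}(N)$; (next) $\star;M\to M$; (prefix pop) $(a\langle x\rangle.N);M\to a\langle x\rangle.(N;M)$ if $x\notin\mathrm{fv}(M)$; (prefix push) $([P]a.N);M\to[P]a.(N;M)$; (associate) $(P;N);M\to P;(N;M)$. Spine reduction $\to_{\mathsf w}$ is the closure of these rules under spine contexts $W::=\{\}\mid a\langle x\rangle.W\mid[M]a.W\mid W;M\mid M;W$ (i.e. everywhere except inside an argument $N$ of $[N]a.M$). A term is spine-normalizing if it reduces by finitely many $\to_{\mathsf w}$ steps to a $\to_{\mathsf w}$-normal form. **Types.** Mutually inductively: computation types $\tau::=\vec I\Rightarrow\vec K$ with $\vec I,\vec K$ memory types; collection types $\iota::=[\tau_1,\dots,\tau_n]$ ($n\ge0$), finite multisets of computation types, with multiset union $\iota+\kappa$; vector types, finite sequences of collection types (last entry = top of stack); memory types, families of vector types indexed by $A$. $\vec K\cdot\iota_a$ is $\vec K$ with $\iota$ added on top at location $a$. A typing context $\Gamma$ is a finitely supported function from variables to collection types (default value $[]$); $\Gamma+\Delta$ is the pointwise sum; in $\Gamma,x:\iota$ it is understood that $\Gamma(x)=[]$. **Weak typing** $\Gamma\vdash_w M:\tau$ and $\Gamma\vdash_w M:\iota$: (variable) $x:[\tau]\vdash x:\tau$; (abstraction) from $\Gamma,x:\iota\vdash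 M:\vec K\Rightarrow\vec L$ infer $\Gamma\vdash a\langle x\rangle.M:\vec K\cdot\iota_a\Rightarrow\vec L$; (application) from $\Gamma\vdash N:\iota$ and $\Delta\vdash M:\vec K\cdot\iota_a\Rightarrow\vec L$ infer $\Gamma+\Delta\vdash[N]a.M:\vec K\Rightarrow\vec L$; (unit) $\vdash\star:\vec I\Rightarrow\vec I$; (sequencing) from $\Gamma\vdash N:\vec I\Rightarrow\vec K$ and $\Delta\vdash M:\vec K\Rightarrow\vec L$ infer $\Gamma+\Delta\vdash N;M:\vec I\Rightarrow\vec L$; (collection) from $\Gamma_i\vdash M:\tau_i$ for $1\le i\le n$ ($n\ge0$) infer $\Gamma_1+\dots+\Gamma_n\vdash M:[\tau_1,\dots,\tau_n]$. -}

module Defs where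

open import Data.Bool.Base using (if_then_else_)
open import Data.Fin.Base using (Fin; zero; suc)
open import Data.Fin.Properties using (inj⇒≟)
open import Data.List.Base using (List; []; _∷_; _++_; foldr)
open import Data.List.Relation.Binary.Permutation.Homogeneous using (Permutation)
open import Data.List.Relation.Binary.Pointwise.Base using (Pointwise)
open import Data.Nat.Base using (ℕ; zero; suc; _+_)
open import Data.Product.Base using (∃; ∃-syntax)
import Data.Vec.Functional as Vec
open import Function.Base using (_∘_; const)
open import Function.Bundles using (_↔_)
open import Function.Properties.Inverse using (↔⇒↣)
open import Relation.Binary.Definitions using (DecidableEquality)
open import Relation.Binary.PropositionalEquality.Core using (_≗_; _≢_)
open import Relation.Binary.Rewriting using (HasNormalForm)
open import Relation.Nullary.Decidable.Core using (does)

record Locations : Set₁ where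
  field
    Loc         : Set
    size        : ℕ
    enumeration : Loc ↔ Fin size
    default     : Loc

  _≟_ : DecidableEquality Loc
  _≟_ = inj⇒≟ (↔⇒↣ enumeration)

module FMC (L : Locations) where
  open Locations L

  -- Lists have the top of the stack at the front, i.e. mirrored with
  -- respect to the usual top-on-the-right notation: S · N at a is S with
  -- N pushed on top of stack a.

  Stacks : Set → Set
  Stacks X = Loc → List X

  infixl 6 _·_at_
  _·_at_ : {X : Set} → Stacks X → X → Loc → Stacks X
  (S · x at a) b = if does (a ≟ b) then x ∷ S b else S b

  -- Well-scoped de Bruijn terms represent α-equivalence classes; Term n
  -- has its free variables among n variables.

  infixr 7 _⨾_

  data Term (n : ℕ) : Set where
    var  : Fin n → Term n
    pop  : Loc → Term (suc n) → Term n        -- a⟨x⟩.M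
    push : Term n → Loc → Term n → Term n     -- [N]a.M
    ⋆    : Term n
    _⨾_  : Term n → Term n → Term n           -- M;N

  private
    variable
      m n : ℕ

  extᵣ : (Fin n → Fin m) → Fin (suc n) → Fin (suc m)
  extᵣ ρ = zero Vec.∷ (suc ∘ ρ)

  rename : (Fin n → Fin m) → Term n → Term m
  rename ρ (var x)      = var (ρ x)
  rename ρ (pop a M)    = pop a (rename (extᵣ ρ) M)
  rename ρ (push N a M) = push (rename ρ N) a (rename ρ M)
  rename ρ ⋆            = ⋆
  rename ρ (M ⨾ N)      = rename ρ M ⨾ rename ρ N

  weaken : Term n → Term (suc n)
  weaken = rename suc

  Subst : ℕ → ℕ → Set
  Subst n m = Fin n → Term m

  ext : Subst n m → Subst (suc n) (suc m)
  ext σ = var zero Vec.∷ (weaken ∘ σ)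

  subst : Subst n m → Term n → Term m
  subst σ (var x)      = σ x
  subst σ (pop a M)    = pop a (subst (ext σ) M)
  subst σ (push N a M) = push (subst σ N) a (subst σ M)
  subst σ ⋆            = ⋆
  subst σ (M ⨾ N)      = subst σ M ⨾ subst σ N

  -- {N/x}M, with x the variable of index zero.
  infixl 8 _[_]
  _[_] : Term (suc n) → Term n → Term n
  M [ N ] = subst (N Vec.∷ var) M

  -- Memories are families of stacks, hence identified when pointwise
  -- equal; the premises using ≗ account for the absence of function
  -- extensionality.

  Memory : ℕ → Set
  Memory n = Stacks (Term n)

  infix 4 _,_⇓[_]_

  data _,_⇓[_]_ {n : ℕ} : Memory n → Term n → ℕ → Memory n → Set where
    unit : ∀ {S T} →
           S ≗ T →
           S , ⋆ ⇓[ 1 ] T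
    seq  : ∀ {R S T M N i j} →
           R , M ⇓[ i ] S →
           S , N ⇓[ j ] T →
           R , M ⨾ N ⇓[ i + j + 1 ] T
    push : ∀ {S T N a M i} →
           S · N at a , M ⇓[ i ] T →
           S , push N a M ⇓[ i + 1 ] T
    pop  : ∀ {R S T N a M i} →
           R ≗ S · N at a →
           S , M [ N ] ⇓[ i ] T →
           R , pop a M ⇓[ i + 1 ] T

  infix 4 _,_⇓_
  _,_⇓_ : Memory n → Term n → Memory n → Set
  S , M ⇓ T = ∃[ i ] S , M ⇓[ i ] T

  MachineTerminating : Term n → Set
  MachineTerminating {n} M =
    ∃[ m ] ∃[ S ] ∃[ T ] ∃ λ (σ : Subst n m) → S , subst σ M ⇓ T

  -- The freshness conditions of passage and prefix-pop
  -- can always be met by α-renaming; here they become weakening of the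
  -- term moved under the binder.

  infix 4 _↦_ _⟶w_

  data _↦_ {n : ℕ} : Term n → Term n → Set where
    beta        : ∀ {N a M} →
                  push N a (pop a M) ↦ M [ N ]
    passage     : ∀ {N a b M} → a ≢ b →
                  push N b (pop a M) ↦ pop a (push (weaken N) b M)
    next        : ∀ {M} →
                  ⋆ ⨾ M ↦ M
    prefix-pop  : ∀ {a N M} →
                  pop a N ⨾ M ↦ pop a (N ⨾ weaken M)
    prefix-push : ∀ {P a N M} →
                  push P a N ⨾ M ↦ push P a (N ⨾ M)
    associate   : ∀ {P N M} →
                  (P ⨾ N) ⨾ M ↦ P ⨾ (N ⨾ M)

  -- Closure under W ::= {} | a⟨x⟩.W | [M]a.W | W;M | M;W.
  data _⟶w_ : Term n → Term n → Set where
    rule   : ∀ {M M′ : Term n} → M ↦ M′ → M ⟶w M′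
    inPop  : ∀ {a} {M M′ : Term (suc n)} → M ⟶w M′ → pop a M ⟶w pop a M′
    inPush : ∀ {N : Term n} {a M M′} → M ⟶w M′ → push N a M ⟶w push N a M′
    inSeqˡ : ∀ {M M′ N : Term n} → M ⟶w M′ → M ⨾ N ⟶w M′ ⨾ N
    inSeqʳ : ∀ {N M M′ : Term n} → M ⟶w M′ → N ⨾ M ⟶w N ⨾ M′

  SpineNormalizing : Term n → Set
  SpineNormalizing {n} = HasNormalForm (_⟶w_ {n})

  -- A finite multiset of computation types is a list of them,
  -- taken up to permutation, hereditarily: _≈_ and _≈ᶜ_ are the equalities
  -- of computation and collection types.

  infix 5 _⇒_

  data Type : Set where
    _⇒_ : Stacks (List Type) → Stacks (List Type) → Type

  Collection : Set
  Collection = List Type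

  infix 4 _≈_ _≈ᶜ_ _≈ᴳ_

  data _≈_ : Type → Type → Set where
    _⇒_ : ∀ {I I′ K K′} →
          (∀ a → Pointwise (Permutation _≈_) (I a) (I′ a)) →
          (∀ a → Pointwise (Permutation _≈_) (K a) (K′ a)) →
          I ⇒ K ≈ I′ ⇒ K′

  _≈ᶜ_ : Collection → Collection → Set
  _≈ᶜ_ = Permutation _≈_

  Context : ℕ → Set
  Context n = Fin n → Collection

  _≈ᴳ_ : Context n → Context n → Set
  Γ ≈ᴳ Δ = ∀ x → Γ x ≈ᶜ Δ x

  ∅ : Context n
  ∅ _ = []

  infixl 6 _⊕_
  _⊕_ : Context n → Context n → Context n
  (Γ ⊕ Δ) x = Γ x ++ Δ x

  ⨁ : List (Context n) → Context n
  ⨁ = foldr _⊕_ ∅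

  -- The context x : ι, with [] at every other variable.
  _↪_ : Fin n → Collection → Context n
  x ↪ ι = Vec.updateAt ∅ x (const ι)

  -- Γ , x : ι with x the variable of index zero.
  infixl 5 _,,_
  _,,_ : Context n → Collection → Context (suc n)
  Γ ,, ι = ι Vec.∷ Γ

  -- The two conversion rules only express that types and contexts are
  -- considered up to equality of multisets and pointwise equality of
  -- families.

  infix 4 _⊢_∶_ _⊢_∶ᶜ_

  mutual
    data _⊢_∶_ {n : ℕ} : Context n → Term n → Type → Set where
      var         : ∀ {x τ} →
                    x ↪ (τ ∷ []) ⊢ var x ∶ τ
      abstraction : ∀ {Γ a ι M K L} →
                    Γ ,, ι ⊢ M ∶ K ⇒ L →
                    Γ ⊢ pop a M ∶ K · ι at a ⇒ L
      application : ∀ {Γ Δ N a ι M K L} →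
                    Γ ⊢ N ∶ᶜ ι →
                    Δ ⊢ M ∶ K · ι at a ⇒ L →
                    Γ ⊕ Δ ⊢ push N a M ∶ K ⇒ L
      unit        : ∀ {I} →
                    ∅ ⊢ ⋆ ∶ I ⇒ I
      sequencing  : ∀ {Γ Δ N M I K L} →
                    Γ ⊢ N ∶ I ⇒ K →
                    Δ ⊢ M ∶ K ⇒ L →
                    Γ ⊕ Δ ⊢ N ⨾ M ∶ I ⇒ L
      conversion  : ∀ {Γ Γ′ M τ τ′} →
                    Γ ≈ᴳ Γ′ → τ ≈ τ′ →
                    Γ ⊢ M ∶ τ →
                    Γ′ ⊢ M ∶ τ′

    data _⊢_∶ᶜ_ {n : ℕ} : Context n → Term n → Collection → Set where
      collection  : ∀ {Γs M τs} →
                    Pointwise (λ Γ τ → Γ ⊢ M ∶ τ) Γs τs →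
                    ⨁ Γs ⊢ M ∶ᶜ τs
      conversion  : ∀ {Γ Γ′ M ι ι′} →
                    Γ ≈ᴳ Γ′ → ι ≈ᶜ ι′ →
                    Γ ⊢ M ∶ᶜ ι →
                    Γ′ ⊢ M ∶ᶜ ι′

  WeaklyTypeable : Term n → Set
  WeaklyTypeable M = ∃[ Γ ] ∃[ τ ] Γ ⊢ M ∶ τ

module Submission where

-- Typeable terms terminate on the machine by realizability: a type denotes the
-- terms that take memories realizing its input to memories realizing its
-- output. Every type is realized, since a term that pushes enough copies of
-- similar terms on every stack meets any finite demand, so the realizability
-- statement can be instantiated.
--
-- A terminating run makes the term strongly spine-normalizing: a spine step
-- either shortens the run (beta, next) or preserves its length and lowers a
-- weight. Conversely spine-normal forms are typeable, hence terminate, and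
-- termination is preserved by expansion along spine steps.
--
-- A run is turned into a typing derivation backwards from its final memory.
-- Replaying it on closures instead of substituted terms lets each binder
-- collect exactly the types at which its argument was used, so no
-- anti-substitution lemma for multisets is needed.

open import Defs
open import Data.Bool.Base using (Bool; true; false; if_then_else_)
open import Data.Empty using (⊥)
open import Data.Fin.Base using (Fin; zero; suc)
open import Data.List.Base using (List; []; _∷_; _++_; drop; map; replicate; allFin)
open import Data.List.Properties using (∷-injectiveˡ)
open import Data.List.Extrema.Nat using (max; xs≤max)
open import Data.List.Membership.Propositional using (_∈_)
open import Data.List.Membership.Propositional.Properties using (∈-map⁺; ∈-allFin)
open import Data.List.Relation.Binary.Permutation.Homogeneous using (refl; prep; swap; trans)
open import Data.List.Relation.Binary.Pointwise.Base using (Pointwise; []; _∷_)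
open import Data.List.Relation.Binary.Prefix.Heterogeneous using (Prefix; []; _∷_)
open import Data.List.Relation.Unary.All as All using (All; []; _∷_)
open import Data.List.Relation.Unary.All.Properties using (++⁺)
open import Data.List.Relation.Unary.Any using (here; there)
open import Data.Nat.Base
  using (ℕ; zero; suc; _+_; _*_; _⊔_; _≤_; _<_; z≤n; s≤s; z<s; s<s; s≤s⁻¹; NonZero; >-nonZero)
open import Data.Nat.Induction using (<-wellFounded)
open import Data.Nat.Properties
  using (≤-refl; <⇒≤; ≤-trans; +-suc; n≤1+n; ≤-reflexive; m<m+n; +-comm; m*n≢0;
         m≤n⇒m≤1+n; m≤m+n; m⊔n≤o⇒m≤o; m⊔n≤o⇒n≤o;
         +-monoˡ-<; +-monoʳ-<; *-monoˡ-<; *-monoʳ-<; *-mono-<;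
         *-mono-≤; m<m*n; module ≤-Reasoning)
open import Data.Nat.Tactic.RingSolver using (solve-∀)
open import Data.Product.Base using (_×_; _,_; ∃; ∃₂; proj₁; proj₂)
open import Data.Product.Function.NonDependent.Propositional using (_×-⇔_)
open import Data.Product.Relation.Binary.Lex.Strict using (×-Lex; ×-wellFounded)
open import Data.Sum.Base using (_⊎_; inj₁; inj₂)
open import Data.Unit.Base using (⊤; tt)
import Data.Vec.Functional as Vec
open import Data.Vec.Functional.Properties using (updateAt-updates)
open import Function.Base using (_∘_; _∘′_; const)
open import Function.Bundles using (_⇔_; mk⇔; Equivalence; Inverse)
open import Function.Construct.Composition using (_⇔-∘_)
open import Function.Construct.Identity using (⇔-id)
open import Induction.WellFounded using (Acc; acc)
open import Relation.Binary.Construct.Closure.ReflexiveTransitive using (Star; ε; _◅_)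
open import Relation.Binary.Rewriting using (IsNormalForm)
open import Relation.Binary.PropositionalEquality
  using (_≡_; _≢_; _≗_; refl; sym; cong; cong₂; module ≡-Reasoning)
  renaming (trans to ≡-trans; subst to ≡-subst)
open import Relation.Nullary using (Dec; contradiction; yes; no; does)
open import Relation.Nullary.Decidable using (dec-true; dec-false)

module WeakTyping (L : Locations) where
  open Locations L
  open FMC L

  private
    variable
      k m n : ℕ
      X Y : Set

  -- Algebra of renaming and substitution.

  ext-cong : {σ τ : Subst n m} → σ ≗ τ → ext σ ≗ ext τ
  ext-cong e zero    = refl
  ext-cong e (suc x) = cong weaken (e x)

  subst-cong : {σ τ : Subst n m} → σ ≗ τ → subst σ ≗ subst τ
  subst-cong e (var x)      = e x
  subst-cong e (pop a M)    = cong (pop a) (subst-cong (ext-cong e) M)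
  subst-cong e (push N a M) = cong₂ (λ N → push N a) (subst-cong e N) (subst-cong e M)
  subst-cong e ⋆            = refl
  subst-cong e (M ⨾ N)      = cong₂ _⨾_ (subst-cong e M) (subst-cong e N)

  ext-var : ext (var {n}) ≗ var
  ext-var zero    = refl
  ext-var (suc x) = refl

  subst-var : (M : Term n) → subst var M ≡ M
  subst-var (var x)      = refl
  subst-var (pop a M)    = cong (pop a) (≡-trans (subst-cong ext-var M) (subst-var M))
  subst-var (push N a M) = cong₂ (λ N → push N a) (subst-var N) (subst-var M)
  subst-var ⋆            = refl
  subst-var (M ⨾ N)      = cong₂ _⨾_ (subst-var M) (subst-var N)

  ext-extᵣ : (σ : Subst m k) (ρ : Fin n → Fin m) → ext σ ∘ extᵣ ρ ≗ ext (σ ∘ ρ)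
  ext-extᵣ σ ρ zero    = refl
  ext-extᵣ σ ρ (suc x) = refl

  subst-rename : (σ : Subst m k) (ρ : Fin n → Fin m) (M : Term n) →
                 subst σ (rename ρ M) ≡ subst (σ ∘ ρ) M
  subst-rename σ ρ (var x)      = refl
  subst-rename σ ρ (pop a M)    =
    cong (pop a) (≡-trans (subst-rename (ext σ) (extᵣ ρ) M) (subst-cong (ext-extᵣ σ ρ) M))
  subst-rename σ ρ (push N a M) = cong₂ (λ N → push N a) (subst-rename σ ρ N) (subst-rename σ ρ M)
  subst-rename σ ρ ⋆            = refl
  subst-rename σ ρ (M ⨾ N)      = cong₂ _⨾_ (subst-rename σ ρ M) (subst-rename σ ρ N)

  rename-as-subst : (ρ : Fin n → Fin m) (M : Term n) → rename ρ M ≡ subst (var ∘ ρ) M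
  rename-as-subst ρ M = ≡-trans (sym (subst-var (rename ρ M))) (subst-rename var ρ M)

  rename-extᵣ-weaken : (ρ : Fin n → Fin m) (M : Term n) →
                       rename (extᵣ ρ) (weaken M) ≡ weaken (rename ρ M)
  rename-extᵣ-weaken ρ M = begin
    rename (extᵣ ρ) (weaken M)            ≡⟨ rename-as-subst (extᵣ ρ) (weaken M) ⟩
    subst (var ∘ extᵣ ρ) (weaken M)       ≡⟨ subst-rename (var ∘ extᵣ ρ) suc M ⟩
    subst (var ∘′ suc ∘′ ρ) M             ≡⟨ subst-rename (var ∘′ suc) ρ M ⟨
    subst (var ∘′ suc) (rename ρ M)        ≡⟨ rename-as-subst suc (rename ρ M) ⟨
    weaken (rename ρ M)                   ∎
    where open ≡-Reasoning

  rename-subst : (ρ : Fin m → Fin k) (σ : Subst n m) (M : Term n) →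
                 rename ρ (subst σ M) ≡ subst (rename ρ ∘ σ) M
  rename-subst ρ σ (var x)      = refl
  rename-subst ρ σ (pop a M)    =
    cong (pop a) (≡-trans (rename-subst (extᵣ ρ) (ext σ) M) (subst-cong ext-rename M))
    where
    ext-rename : rename (extᵣ ρ) ∘ ext σ ≗ ext (rename ρ ∘ σ)
    ext-rename zero    = refl
    ext-rename (suc x) = rename-extᵣ-weaken ρ (σ x)
  rename-subst ρ σ (push N a M) = cong₂ (λ N → push N a) (rename-subst ρ σ N) (rename-subst ρ σ M)
  rename-subst ρ σ ⋆            = refl
  rename-subst ρ σ (M ⨾ N)      = cong₂ _⨾_ (rename-subst ρ σ M) (rename-subst ρ σ N)

  subst-ext-weaken : (σ : Subst n m) (M : Term n) →
                     subst (ext σ) (weaken M) ≡ weaken (subst σ M)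
  subst-ext-weaken σ M =
    ≡-trans (subst-rename (ext σ) suc M) (sym (rename-subst suc σ M))

  subst-subst : (σ : Subst m k) (τ : Subst n m) (M : Term n) →
                subst σ (subst τ M) ≡ subst (subst σ ∘ τ) M
  subst-subst σ τ (var x)      = refl
  subst-subst σ τ (pop a M)    =
    cong (pop a) (≡-trans (subst-subst (ext σ) (ext τ) M) (subst-cong ext-subst M))
    where
    ext-subst : subst (ext σ) ∘ ext τ ≗ ext (subst σ ∘ τ)
    ext-subst zero    = refl
    ext-subst (suc x) = subst-ext-weaken σ (τ x)
  subst-subst σ τ (push N a M) = cong₂ (λ N → push N a) (subst-subst σ τ N) (subst-subst σ τ M)
  subst-subst σ τ ⋆            = refl
  subst-subst σ τ (M ⨾ N)      = cong₂ _⨾_ (subst-subst σ τ M) (subst-subst σ τ N)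

  weaken-[] : (M : Term n) (N : Term n) → weaken M [ N ] ≡ M
  weaken-[] M N = ≡-trans (subst-rename (N Vec.∷ var) suc M) (subst-var M)

  subst-ext-[] : (σ : Subst n m) (M : Term (suc n)) (N : Term m) →
                 subst (ext σ) M [ N ] ≡ subst (N Vec.∷ σ) M
  subst-ext-[] σ M N = ≡-trans (subst-subst (N Vec.∷ var) (ext σ) M) (subst-cong pointwise M)
    where
    pointwise : subst (N Vec.∷ var) ∘ ext σ ≗ N Vec.∷ σ
    pointwise zero    = refl
    pointwise (suc x) = weaken-[] (σ x) N

  subst-[] : (σ : Subst n m) (M : Term (suc n)) (N : Term n) →
             subst σ (M [ N ]) ≡ subst (subst σ N Vec.∷ σ) M
  subst-[] σ M N = ≡-trans (subst-subst σ (N Vec.∷ var) M) (subst-cong pointwise M)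
    where
    pointwise : subst σ ∘ (N Vec.∷ var) ≗ subst σ N Vec.∷ σ
    pointwise zero    = refl
    pointwise (suc x) = refl

  subst-∷-weaken : (σ : Subst n m) (M : Term n) (N : Term m) →
                   subst (N Vec.∷ σ) (weaken M) ≡ subst σ M
  subst-∷-weaken σ M N = subst-rename (N Vec.∷ σ) suc M

  -- Pushes and pops on families of stacks.

  data At (a : Loc) : Loc → Bool → Set where
    here  : At a a true
    there : ∀ {b} → a ≢ b → At a b false

  -- Abstracted together with the boolean on which `_·_at_` branches, this view gives each branch
  -- its equality or inequality of locations.
  at : (a b : Loc) → At a b (does (a ≟ b))
  at a b = view (a ≟ b)
    where
    view : (d : Dec (a ≡ b)) → At a b (does d)
    view (yes refl) = here
    view (no a≢b)   = there a≢b

  -- Written with `drop` to be total: an empty stack stays empty, so no proof of nonemptiness has to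
  -- be carried around.
  popAt : Loc → Stacks X → Stacks X
  popAt a S b = drop (if does (a ≟ b) then 1 else 0) (S b)

  ·-here : (S : Stacks X) (x : X) (a : Loc) → (S · x at a) a ≡ x ∷ S a
  ·-here S x a rewrite dec-true (a ≟ a) refl = refl

  ·-cong : {S T : Stacks X} {x : X} {a : Loc} → S ≗ T → S · x at a ≗ T · x at a
  ·-cong {a = a} e b with does (a ≟ b) | at a b
  ... | true | _ = cong (_ ∷_) (e b)
  ... | false | _ = e b

  ·-comm : (S : Stacks X) (x y : X) {a b : Loc} → a ≢ b →
           S · x at a · y at b ≗ S · y at b · x at a
  ·-comm S x y {a} {b} a≢b c with does (a ≟ c) | at a c | does (b ≟ c) | at b c
  ... | true | here | true | here = contradiction refl a≢b
  ... | true | _ | false | _ = refl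
  ... | false | _ | true | _ = refl
  ... | false | _ | false | _ = refl

  popAt-cong : {S T : Stacks X} (a : Loc) → S ≗ T → popAt a S ≗ popAt a T
  popAt-cong a e b = cong (drop (if does (a ≟ b) then 1 else 0)) (e b)

  popAt-· : (S : Stacks X) (x : X) (a : Loc) → popAt a (S · x at a) ≗ S
  popAt-· S x a b with does (a ≟ b) | at a b
  ... | true | _ = refl
  ... | false | _ = refl

  popAt-·-≢ : (S : Stacks X) (x : X) {a b : Loc} → a ≢ b →
              popAt a (S · x at b) ≗ popAt a S · x at b
  popAt-·-≢ S x {a} {b} a≢b c with does (a ≟ c) | at a c | does (b ≟ c) | at b c
  ... | true | here | true | here = contradiction refl a≢b
  ... | true | _ | false | _ = refl
  ... | false | _ | true | _ = refl
  ... | false | _ | false | _ = refl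

  ·-popAt : {S : Stacks X} {x : X} {s : List X} {a : Loc} → S a ≡ x ∷ s →
            S ≗ popAt a S · x at a
  ·-popAt {a = a} e b with does (a ≟ b) | at a b
  ... | true | here = ≡-trans e (cong (λ t → _ ∷ drop 1 t) (sym e))
  ... | false | _ = refl

  ·-injectiveˡ : {S T : Stacks X} {x y : X} {a : Loc} → S · x at a ≗ T · y at a → S ≗ T
  ·-injectiveˡ {S = S} {T} {x} {y} {a} e b =
    ≡-trans (sym (popAt-· S x a b)) (≡-trans (popAt-cong a e b) (popAt-· T y a b))

  ·-injectiveʳ : {S T : Stacks X} {x y : X} {a : Loc} → S · x at a ≗ T · y at a → x ≡ y
  ·-injectiveʳ {S = S} {T} {x} {y} {a} e =
    ∷-injectiveˡ (≡-trans (sym (·-here S x a)) (≡-trans (e a) (·-here T y a)))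

  -- Two pushes at different locations that agree overlap in popAt a S.
  ·-diamond : {S T : Stacks X} {x y : X} {a b : Loc} → a ≢ b →
              S · x at b ≗ T · y at a →
              S ≗ popAt a S · y at a × T ≗ popAt a S · x at b
  ·-diamond {S = S} {T} {x} {y} {a} {b} a≢b e = ·-popAt S≡ , T≗
    where
    S≡ : S a ≡ y ∷ T a
    S≡ = begin
      S a             ≡⟨ S·x≡ ⟨
      (S · x at b) a  ≡⟨ e a ⟩
      (T · y at a) a  ≡⟨ ·-here T y a ⟩
      y ∷ T a         ∎
      where
      open ≡-Reasoning
      S·x≡ : (S · x at b) a ≡ S a
      S·x≡ rewrite dec-false (b ≟ a) (a≢b ∘ sym) = refl
    T≗ : T ≗ popAt a S · x at b
    T≗ c = begin
      T c                       ≡⟨ popAt-· T y a c ⟨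
      popAt a (T · y at a) c    ≡⟨ popAt-cong a e c ⟨
      popAt a (S · x at b) c    ≡⟨ popAt-·-≢ S x a≢b c ⟩
      (popAt a S · x at b) c    ∎
      where open ≡-Reasoning

  -- Runs of substituted terms and their decrease along spine steps.

  ⇓-resp-≗ : {S S′ T : Memory n} {M : Term n} {i : ℕ} → S ≗ S′ →
             S , M ⇓[ i ] T → S′ , M ⇓[ i ] T
  ⇓-resp-≗ e (unit f)  = unit λ a → ≡-trans (sym (e a)) (f a)
  ⇓-resp-≗ e (seq r s) = seq (⇓-resp-≗ e r) s
  ⇓-resp-≗ e (push r)  = push (⇓-resp-≗ (·-cong e) r)
  ⇓-resp-≗ e (pop f r) = pop (λ a → ≡-trans (sym (e a)) (f a)) r

  module _ {σ : Subst n m} {a : Loc} {M : Term (suc n)} {R T : Memory m} where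

    -- The popped term is absorbed into the substitution. A step under a binder is then an instance
    -- of the induction hypothesis at `N Vec.∷ σ`.
    pop⁺ : ∀ {S N i} → R ≗ S · N at a → S , subst (N Vec.∷ σ) M ⇓[ i ] T →
           R , subst σ (pop a M) ⇓[ i + 1 ] T
    pop⁺ {N = N} e r = pop e (≡-subst (_ ,_⇓[ _ ] _) (sym (subst-ext-[] σ M N)) r)

    data Pop : ℕ → Set where
      popped : ∀ {S N i} → R ≗ S · N at a → S , subst (N Vec.∷ σ) M ⇓[ i ] T → Pop (i + 1)

    pop⁻ : ∀ {i} → R , subst σ (pop a M) ⇓[ i ] T → Pop i
    pop⁻ (pop {N = N} e r) = popped e (≡-subst (_ ,_⇓[ _ ] _) (subst-ext-[] σ M N) r)

  -- Chosen so that the rules preserving run length decrease it: the successor at `pop` and the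
  -- doubling at `push` give `2x + 1 < 2(x + 1)` for `passage`, and squaring the left factor of a
  -- sequence handles `associate` and both prefix rules. All clauses are monotone in the spine
  -- positions.
  weight : Term n → ℕ
  weight (var x)      = 2
  weight (pop a M)    = suc (weight M)
  weight (push N a M) = 2 * weight M
  weight ⋆            = 2
  weight (M ⨾ N)      = weight M * weight M * weight N

  weight-rename : (ρ : Fin n → Fin m) (M : Term n) → weight (rename ρ M) ≡ weight M
  weight-rename ρ (var x)      = refl
  weight-rename ρ (pop a M)    = cong suc (weight-rename (extᵣ ρ) M)
  weight-rename ρ (push N a M) = cong (2 *_) (weight-rename ρ M)
  weight-rename ρ ⋆            = refl
  weight-rename ρ (M ⨾ N)      =
    cong₂ (λ x y → x * x * y) (weight-rename ρ M) (weight-rename ρ N)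

  1<weight : (M : Term n) → 1 < weight M
  1<weight (var x)      = ≤-refl
  1<weight (pop a M)    = m≤n⇒m≤1+n (1<weight M)
  1<weight (push N a M) = ≤-trans (1<weight M) (m≤m+n _ _)
  1<weight ⋆            = ≤-refl
  1<weight (M ⨾ N)      = *-mono-≤ {1} (*-mono-≤ {1} 0<w 0<w) (1<weight N)
    where 0<w = <⇒≤ (1<weight M)

  weight-nonZero : (M : Term n) → NonZero (weight M)
  weight-nonZero M = >-nonZero (≤-trans (s≤s z≤n) (1<weight M))

  infix 4 _≺_
  _≺_ : ℕ × ℕ → ℕ × ℕ → Set
  _≺_ = ×-Lex _≡_ _<_ _<_

  -- The weight is taken before `σ` is applied, so it does not change when `σ` is extended by a
  -- popped term.
  ↦-run : {M M′ : Term n} → M ↦ M′ → (σ : Subst n m) {S T : Memory m} {i : ℕ} →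
          S , subst σ M ⇓[ i ] T →
          ∃ λ j → S , subst σ M′ ⇓[ j ] T × (j , weight M′) ≺ (i , weight M)
  ↦-run (beta {N} {a} {M}) σ (push r) with pop⁻ {M = M} r
  ... | popped {i = i} e r′ with refl ← ·-injectiveʳ {a = a} e =
    i ,
    ≡-subst (_ ,_⇓[ i ] _) (sym (subst-[] σ M N)) (⇓-resp-≗ (sym ∘ ·-injectiveˡ {a = a} e) r′) ,
    -- `beta` saves one push and one pop, hence two units of length.
    inj₁ (≤-trans (m<m+n i z<s) (m≤m+n (i + 1) 1))
  ↦-run (passage {N} {a} {b} {M} a≢b) σ (push r) with pop⁻ {M = M} r
  -- The popped `P` already lay on stack `a` before the push on `b`, so it can be popped first.
  ... | popped {N = P} {i} e r′ with e₁ , e₂ ← ·-diamond a≢b e =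
    i + 1 + 1 ,
    pop⁺ {M = push (weaken N) b M} e₁
      (≡-subst (λ Q → _ , push Q b _ ⇓[ _ ] _) (sym (subst-∷-weaken σ N P)) (push (⇓-resp-≗ e₂ r′))) ,
    inj₂ (refl , passage-weight (weight M))
    where
    passage-weight : ∀ x → suc (2 * x) < 2 * suc x
    passage-weight x = ≤-reflexive (lemma x)
      where
      lemma : ∀ x → suc (suc (2 * x)) ≡ 2 * suc x
      lemma = solve-∀
  ↦-run next σ (seq {j = j} (unit e) r) =
    j , ⇓-resp-≗ (sym ∘ e) r , inj₁ (s≤s (m≤m+n j 1))
  ↦-run (prefix-pop {a} {N} {M}) σ (seq {j = j} r s) with pop⁻ {M = N} r
  ... | popped {N = P} {i} e r′ =
    i + j + 1 + 1 ,
    pop⁺ {M = N ⨾ weaken M} e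
      (seq r′ (≡-subst (_ ,_⇓[ j ] _) (sym (subst-∷-weaken σ M P)) s)) ,
    inj₂ (run-length i j , prefix-pop-weight)
    where
    run-length : ∀ i j → i + j + 1 + 1 ≡ i + 1 + j + 1
    run-length = solve-∀
    expand : ∀ x y → suc (x * x * y) + (y + 2 * (x * y)) ≡ suc (suc x * suc x * y)
    expand = solve-∀
    prefix-pop-weight : weight (pop a (N ⨾ weaken M)) < weight (pop a N ⨾ M)
    -- The slack is `y + 2xy` with `y` the weight of `M`; it exceeds one because every weight does.
    prefix-pop-weight rewrite weight-rename suc M = s≤s⁻¹ (begin-strict
      suc (suc x′)                 ≡⟨ +-comm 1 (suc x′) ⟩
      suc x′ + 1                   <⟨ +-monoʳ-< (suc x′) (≤-trans (1<weight M) (m≤m+n _ _)) ⟩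
      suc x′ + (weight M + 2 * (weight N * weight M))  ≡⟨ expand (weight N) (weight M) ⟩
      suc (suc (weight N) * suc (weight N) * weight M) ∎)
      where
      open ≤-Reasoning
      x′ = weight N * weight N * weight M
  ↦-run (prefix-push {P} {a} {N} {M}) σ (seq {j = j} (push {i = i} r) s) =
    i + j + 1 + 1 , push (seq r s) , inj₂ (run-length i j , prefix-push-weight)
    where
    run-length : ∀ i j → i + j + 1 + 1 ≡ i + 1 + j + 1
    run-length = solve-∀
    expand : ∀ x y → 4 * (x * x * y) ≡ 2 * x * (2 * x) * y
    expand = solve-∀
    prefix-push-weight : weight (push P a (N ⨾ M)) < weight (push P a N ⨾ M)
    prefix-push-weight = begin-strict
      2 * weight (N ⨾ M)      <⟨ *-monoˡ-< (weight (N ⨾ M)) {{weight-nonZero (N ⨾ M)}} {2} {4} (s≤s (s≤s (s≤s z≤n))) ⟩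
      4 * weight (N ⨾ M)      ≡⟨ expand (weight N) (weight M) ⟩
      weight (push P a N ⨾ M) ∎
      where open ≤-Reasoning
  ↦-run (associate {P} {N} {M}) σ (seq {j = k} (seq {i = i} {j} r s) t) =
    i + (j + k + 1) + 1 , seq r (seq s t) , inj₂ (run-length i j k , associate-weight)
    where
    run-length : ∀ i j k → i + (j + k + 1) + 1 ≡ i + j + 1 + k + 1
    run-length = solve-∀
    expand : ∀ x y z → x * x * (y * y * z) * (x * x) ≡ x * x * y * (x * x * y) * z
    expand = solve-∀
    associate-weight : weight (P ⨾ (N ⨾ M)) < weight ((P ⨾ N) ⨾ M)
    associate-weight = begin-strict
      -- The two weights differ by the factor `weight P * weight P`, which is at least four.
      weight (P ⨾ (N ⨾ M))                         <⟨ m<m*n _ _ {{weight-nonZero (P ⨾ (N ⨾ M))}}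
                                                       (≤-trans (s≤s (s≤s z≤n)) (*-mono-≤ (1<weight P) (1<weight P))) ⟩
      weight (P ⨾ (N ⨾ M)) * (weight P * weight P) ≡⟨ expand (weight P) (weight N) (weight M) ⟩
      weight ((P ⨾ N) ⨾ M)                         ∎
      where open ≤-Reasoning

  ≺-cong : {f g : ℕ → ℕ} → (∀ {x y} → x < y → f x < f y) → (∀ {x y} → x < y → g x < g y) →
           ∀ {i j v w} → (j , v) ≺ (i , w) → (f j , g v) ≺ (f i , g w)
  ≺-cong f-mono g-mono (inj₁ j<i)          = inj₁ (f-mono j<i)
  ≺-cong f-mono g-mono (inj₂ (refl , v<w)) = inj₂ (refl , g-mono v<w)

  ⟶w-run : {M M′ : Term n} → M ⟶w M′ → (σ : Subst n m) {S T : Memory m} {i : ℕ} →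
           S , subst σ M ⇓[ i ] T →
           ∃ λ j → S , subst σ M′ ⇓[ j ] T × (j , weight M′) ≺ (i , weight M)
  ⟶w-run (rule s) σ r = ↦-run s σ r
  ⟶w-run (inPop {M = M} {M′} s) σ r with pop⁻ {M = M} r
  ... | popped {N = N} e r′ with j , r″ , lt ← ⟶w-run s (N Vec.∷ σ) r′ =
    j + 1 , pop⁺ {M = M′} e r″ , ≺-cong (+-monoˡ-< 1) s<s lt
  ⟶w-run (inPush s) σ (push r) with j , r′ , lt ← ⟶w-run s σ r =
    j + 1 , push r′ , ≺-cong (+-monoˡ-< 1) (*-monoʳ-< 2) lt
  ⟶w-run (inSeqˡ {N = N} s) σ (seq {j = k} r t) with j , r′ , lt ← ⟶w-run s σ r =
    j + k + 1 , seq r′ t ,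
    ≺-cong (λ p → +-monoˡ-< 1 (+-monoˡ-< k p))
           (λ p → *-monoˡ-< (weight N) {{weight-nonZero N}} (*-mono-< p p)) lt
  ⟶w-run (inSeqʳ {N = N} s) σ (seq {i = k} r t) with j , t′ , lt ← ⟶w-run s σ t =
    k + j + 1 , seq r t′ ,
    ≺-cong (λ p → +-monoˡ-< 1 (+-monoʳ-< k p))
           (*-monoʳ-< (weight N * weight N)
             {{m*n≢0 (weight N) (weight N) {{weight-nonZero N}} {{weight-nonZero N}}}}) lt

  -- Termination is preserved by expansion.

  ↦-expand : {M M′ : Term n} → M ↦ M′ → (σ : Subst n m) {S T : Memory m} →
             S , subst σ M′ ⇓ T → S , subst σ M ⇓ T
  ↦-expand (beta {N} {a} {M}) σ (_ , r) =
    _ , push (pop⁺ {M = M} (λ _ → refl) (≡-subst (_ ,_⇓[ _ ] _) (subst-[] σ M N) r))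
  ↦-expand (passage {N} {a} {b} {M} a≢b) σ (_ , r) with pop⁻ {M = push (weaken N) b M} r
  ... | popped {S} {P} e (push r′) =
    _ , push (pop⁺ {M = M} (λ c → ≡-trans (·-cong e c) (·-comm S P (subst σ N) a≢b c))
          (≡-subst (λ Q → _ · Q at b , _ ⇓[ _ ] _) (subst-∷-weaken σ N P) r′))
  ↦-expand next σ (_ , r) = _ , seq (unit (λ _ → refl)) r
  ↦-expand (prefix-pop {a} {N} {M}) σ (_ , r) with pop⁻ {M = N ⨾ weaken M} r
  ... | popped {N = P} e (seq r′ s) =
    _ , seq (pop⁺ {M = N} e r′) (≡-subst (_ ,_⇓[ _ ] _) (subst-∷-weaken σ M P) s)
  ↦-expand prefix-push σ (_ , push (seq r s)) = _ , seq (push r) s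
  ↦-expand associate σ (_ , seq r (seq s t)) = _ , seq (seq r s) t

  ⟶w-expand : {M M′ : Term n} → M ⟶w M′ → (σ : Subst n m) {S T : Memory m} →
              S , subst σ M′ ⇓ T → S , subst σ M ⇓ T
  ⟶w-expand (rule s) σ r = ↦-expand s σ r
  ⟶w-expand (inPop {M = M} {M′} s) σ (_ , r) with pop⁻ {M = M′} r
  ... | popped {N = N} e r′ = _ , pop⁺ {M = M} e (proj₂ (⟶w-expand s (N Vec.∷ σ) (_ , r′)))
  ⟶w-expand (inPush s) σ (_ , push r)  = _ , push (proj₂ (⟶w-expand s σ (_ , r)))
  ⟶w-expand (inSeqˡ s) σ (_ , seq r t) = _ , seq (proj₂ (⟶w-expand s σ (_ , r))) t
  ⟶w-expand (inSeqʳ s) σ (_ , seq r t) = _ , seq r (proj₂ (⟶w-expand s σ (_ , t)))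

  MachineTerminating-expand : {M M′ : Term n} → Star _⟶w_ M M′ →
                              MachineTerminating M′ → MachineTerminating M
  MachineTerminating-expand ε        t = t
  MachineTerminating-expand (s ◅ ss) t with m , S , T , σ , r ← MachineTerminating-expand ss t =
    m , S , T , σ , ⟶w-expand s σ r

  -- Inductive description of spine-normal forms.

  mutual
    data Normal {n : ℕ} : Term n → Set where
      pop     : ∀ {a M} → Normal M → Normal (pop a M)
      neutral : ∀ {M} → Neutral M → Normal M

    -- These are the normal forms that are not abstractions, so a `push` onto one creates no redex.
    -- A sequence is normal only with a variable on its left, since any other left component fires a
    -- rule.
    data Neutral {n : ℕ} : Term n → Set where
      var  : ∀ {x} → Neutral (var x)
      push : ∀ {N a M} → Neutral M → Neutral (push N a M)
      ⋆    : Neutral ⋆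
      seq  : ∀ {x M} → Normal M → Neutral (var x ⨾ M)

  mutual
    Normal⇒IsNormalForm : {M : Term n} → Normal M → IsNormalForm _⟶w_ M
    Normal⇒IsNormalForm (pop p)     (_ , inPop s) = Normal⇒IsNormalForm p (_ , s)
    Normal⇒IsNormalForm (neutral p) s             = Neutral⇒IsNormalForm p s

    Neutral⇒IsNormalForm : {M : Term n} → Neutral M → IsNormalForm _⟶w_ M
    Neutral⇒IsNormalForm var      (_ , rule ())
    Neutral⇒IsNormalForm (push ()) (_ , rule beta)
    Neutral⇒IsNormalForm (push ()) (_ , rule (passage _))
    Neutral⇒IsNormalForm (push p) (_ , inPush s)       = Neutral⇒IsNormalForm p (_ , s)
    Neutral⇒IsNormalForm ⋆        (_ , rule ())
    Neutral⇒IsNormalForm (seq p)  (_ , inSeqˡ (rule ()))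
    Neutral⇒IsNormalForm (seq p)  (_ , inSeqʳ s)       = Normal⇒IsNormalForm p (_ , s)

  progress : (M : Term n) → Normal M ⊎ ∃ λ M′ → M ⟶w M′
  progress (var x) = inj₁ (neutral var)
  progress (pop a M) with progress M
  ... | inj₁ p       = inj₁ (pop p)
  ... | inj₂ (_ , s) = inj₂ (_ , inPop s)
  progress (push N b M) with progress M
  ... | inj₂ (_ , s)       = inj₂ (_ , inPush s)
  ... | inj₁ (neutral p)   = inj₁ (neutral (push p))
  ... | inj₁ (pop {a} _) with a ≟ b
  ...   | yes refl = inj₂ (_ , rule beta)
  ...   | no a≢b   = inj₂ (_ , rule (passage a≢b))
  progress ⋆ = inj₁ (neutral ⋆)
  progress (var x ⨾ N) with progress N
  ... | inj₁ p       = inj₁ (neutral (seq p))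
  ... | inj₂ (_ , s) = inj₂ (_ , inSeqʳ s)
  progress (pop a M ⨾ N)    = inj₂ (_ , rule prefix-pop)
  progress (push P a M ⨾ N) = inj₂ (_ , rule prefix-push)
  progress (⋆ ⨾ N)          = inj₂ (_ , rule next)
  progress ((P ⨾ M) ⨾ N)    = inj₂ (_ , rule associate)

  IsNormalForm⇒Normal : {M : Term n} → IsNormalForm _⟶w_ M → Normal M
  IsNormalForm⇒Normal {M = M} nf with progress M
  ... | inj₁ p = p
  ... | inj₂ s = contradiction s nf

  MachineTerminating⇒SpineNormalizing : {M : Term n} → MachineTerminating M → SpineNormalizing M
  MachineTerminating⇒SpineNormalizing (_ , _ , _ , σ , i , r) =
    normalize r (×-wellFounded <-wellFounded <-wellFounded _)
    where
    normalize : ∀ {M S T i} → S , subst σ M ⇓[ i ] T → Acc _≺_ (i , weight M) → SpineNormalizing M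
    normalize {M = M} r (acc rs) with progress M
    ... | inj₁ p       = M , Normal⇒IsNormalForm p , ε
    ... | inj₂ (_ , s) with _ , r′ , lt ← ⟶w-run s σ r
                       with N , nf , ss ← normalize r′ (rs lt) = N , nf , s ◅ ss

  -- Realizability and soundness of weak typing.

  infix 4 _⊩_ _⊩ᶜ_ _⊩ˢ_ _⊩ᵐ_

  mutual
    _⊩_ : Term n → Type → Set
    M ⊩ (I ⇒ K) = ∀ S → (∀ a → S a ⊩ˢ I a) → ∃ λ T → S , M ⇓ T × (∀ a → T a ⊩ˢ K a)

    -- A collection is read as an intersection, which forgets multiplicities and order.
    _⊩ᶜ_ : Term n → Collection → Set
    M ⊩ᶜ []      = ⊤
    M ⊩ᶜ (τ ∷ ι) = M ⊩ τ × M ⊩ᶜ ι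

    -- Only the top of a stack is constrained; hence I plays no role in the
    -- inhabitation of I ⇒ K.
    _⊩ˢ_ : List (Term n) → List Collection → Set
    s       ⊩ˢ []       = ⊤
    []      ⊩ˢ (ι ∷ ιs) = ⊥
    (N ∷ s) ⊩ˢ (ι ∷ ιs) = N ⊩ᶜ ι × s ⊩ˢ ιs

  _⊩ᵐ_ : Memory n → Stacks Collection → Set
  S ⊩ᵐ I = ∀ a → S a ⊩ˢ I a

  ⊩-⇒-map : {M : Term n} {I J K L : Stacks Collection} →
            (∀ {s : List (Term n)} a → s ⊩ˢ J a → s ⊩ˢ I a) →
            (∀ {s : List (Term n)} a → s ⊩ˢ K a → s ⊩ˢ L a) →
            M ⊩ (I ⇒ K) → M ⊩ (J ⇒ L)
  ⊩-⇒-map f g h S s with T , r , t ← h S (λ a → f a (s a)) = T , r , λ a → g a (t a)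

  mutual
    -- An equivalence is proved because the input of a computation type is contravariant: each
    -- direction there uses the opposite one.
    ⊩-resp-≈ : {M : Term n} {τ τ′ : Type} → τ ≈ τ′ → M ⊩ τ ⇔ M ⊩ τ′
    ⊩-resp-≈ {M = M} (p ⇒ q) = mk⇔
      (⊩-⇒-map {M = M} (λ a → from (⊩ˢ-resp-≈ (p a))) (λ a → to (⊩ˢ-resp-≈ (q a))))
      (⊩-⇒-map {M = M} (λ a → to (⊩ˢ-resp-≈ (p a))) (λ a → from (⊩ˢ-resp-≈ (q a))))
      where open Equivalence

    ⊩ˢ-resp-≈ : {s : List (Term n)} {ιs κs : List Collection} → Pointwise _≈ᶜ_ ιs κs →
                s ⊩ˢ ιs ⇔ s ⊩ˢ κs
    ⊩ˢ-resp-≈               []       = ⇔-id _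
    ⊩ˢ-resp-≈ {s = []}      (c ∷ cs) = ⇔-id _
    ⊩ˢ-resp-≈ {s = N ∷ s}   (c ∷ cs) = ⊩ᶜ-resp-≈ c ×-⇔ ⊩ˢ-resp-≈ cs

    ⊩ᶜ-resp-≈ : {M : Term n} {ι κ : Collection} → ι ≈ᶜ κ → M ⊩ᶜ ι ⇔ M ⊩ᶜ κ
    ⊩ᶜ-resp-≈ (refl p)     = ⊩ᶜ-resp-Pointwise p
    ⊩ᶜ-resp-≈ (prep e p)   = ⊩-resp-≈ e ×-⇔ ⊩ᶜ-resp-≈ p
    ⊩ᶜ-resp-≈ (swap e f p) =
      mk⇔ (λ (x , y , z) → y , x , z) (λ (x , y , z) → y , x , z) ⇔-∘
      (⊩-resp-≈ e ×-⇔ (⊩-resp-≈ f ×-⇔ ⊩ᶜ-resp-≈ p))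
    ⊩ᶜ-resp-≈ (trans p q)  = ⊩ᶜ-resp-≈ q ⇔-∘ ⊩ᶜ-resp-≈ p

    ⊩ᶜ-resp-Pointwise : {M : Term n} {ι κ : Collection} → Pointwise _≈_ ι κ → M ⊩ᶜ ι ⇔ M ⊩ᶜ κ
    ⊩ᶜ-resp-Pointwise []       = ⇔-id _
    ⊩ᶜ-resp-Pointwise (e ∷ es) = ⊩-resp-≈ e ×-⇔ ⊩ᶜ-resp-Pointwise es

  ⊩ᶜ-++⁻ : {M : Term n} (ι : Collection) {κ : Collection} → M ⊩ᶜ ι ++ κ → M ⊩ᶜ ι × M ⊩ᶜ κ
  ⊩ᶜ-++⁻ []      p       = tt , p
  ⊩ᶜ-++⁻ (τ ∷ ι) (p , q) = let q₁ , q₂ = ⊩ᶜ-++⁻ ι q in (p , q₁) , q₂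

  ⊩ᵐ-push : {S : Memory n} {K : Stacks Collection} {N : Term n} {ι : Collection} {a : Loc} →
            S ⊩ᵐ K → N ⊩ᶜ ι → S · N at a ⊩ᵐ K · ι at a
  ⊩ᵐ-push {a = a} s p b with does (a ≟ b)
  ... | true  = p , s b
  ... | false = s b

  ⊩ᵐ-pop : {S : Memory n} (K : Stacks Collection) (ι : Collection) {a : Loc} →
           S ⊩ᵐ K · ι at a →
           ∃ λ N → S ≗ popAt a S · N at a × N ⊩ᶜ ι × popAt a S ⊩ᵐ K
  ⊩ᵐ-pop {S = S} K ι {a} p with S a in eq | ≡-subst (S a ⊩ˢ_) (·-here K ι a) (p a)
  ... | N ∷ s | q , _ = N , ·-popAt eq , q , rest
    where
    rest : popAt a S ⊩ᵐ K
    rest b with does (a ≟ b) | at a b | p b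
    ... | false | _    | pb = pb
    ... | true  | here | pb with _ ∷ _ ← S a | _ , pb′ ← pb = pb′

  infix 4 _⊩ᴳ_
  _⊩ᴳ_ : Subst n m → Context n → Set
  σ ⊩ᴳ Γ = ∀ x → σ x ⊩ᶜ Γ x

  ⊩ᴳ-⊕⁻ : {σ : Subst n m} (Γ : Context n) {Δ : Context n} → σ ⊩ᴳ Γ ⊕ Δ → σ ⊩ᴳ Γ × σ ⊩ᴳ Δ
  ⊩ᴳ-⊕⁻ Γ p = (λ x → proj₁ (⊩ᶜ-++⁻ (Γ x) (p x))) , (λ x → proj₂ (⊩ᶜ-++⁻ (Γ x) (p x)))

  mutual
    -- Induction on the derivation for all realizing substitutions at once, so that an abstraction
    -- can extend the substitution by the term it pops.
    soundness : {Γ : Context n} {M : Term n} {τ : Type} → Γ ⊢ M ∶ τ →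
                (σ : Subst n m) → σ ⊩ᴳ Γ → subst σ M ⊩ τ
    soundness (var {x} {τ}) σ p =
      proj₁ (≡-subst (σ x ⊩ᶜ_) (updateAt-updates x ∅) (p x))
    soundness (abstraction {ι = ι} {M} {K} d) σ p S s
      with N , e , q , s′ ← ⊩ᵐ-pop K ι s
      with T , (_ , r) , t ← soundness d (N Vec.∷ σ) (λ { zero → q ; (suc x) → p x }) _ s′ =
      T , (_ , pop⁺ {M = M} e r) , t
    soundness (application {Γ} d e) σ p S s
      with p₁ , p₂ ← ⊩ᴳ-⊕⁻ Γ p
      with T , (_ , r) , t ← soundness e σ p₂ _ (⊩ᵐ-push s (soundnessᶜ d σ p₁)) =
      T , (_ , push r) , t
    soundness unit σ p S s = S , (_ , unit (λ _ → refl)) , s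
    soundness (sequencing {Γ} d e) σ p R r
      with p₁ , p₂ ← ⊩ᴳ-⊕⁻ Γ p
      with S , (_ , x) , s ← soundness d σ p₁ R r
      with T , (_ , y) , t ← soundness e σ p₂ S s =
      T , (_ , seq x y) , t
    soundness (conversion c e d) σ p =
      Equivalence.to (⊩-resp-≈ e)
        (soundness d σ (λ x → Equivalence.from (⊩ᶜ-resp-≈ (c x)) (p x)))

    soundnessᶜ : {Γ : Context n} {M : Term n} {ι : Collection} → Γ ⊢ M ∶ᶜ ι →
                 (σ : Subst n m) → σ ⊩ᴳ Γ → subst σ M ⊩ᶜ ι
    soundnessᶜ (collection ds)    σ p = soundness* ds σ p
    soundnessᶜ (conversion c e d) σ p =
      Equivalence.to (⊩ᶜ-resp-≈ e)
        (soundnessᶜ d σ (λ x → Equivalence.from (⊩ᶜ-resp-≈ (c x)) (p x)))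

    soundness* : {Γs : List (Context n)} {M : Term n} {ι : Collection} →
                 Pointwise (λ Γ τ → Γ ⊢ M ∶ τ) Γs ι →
                 (σ : Subst n m) → σ ⊩ᴳ ⨁ Γs → subst σ M ⊩ᶜ ι
    soundness* []                σ p = tt
    soundness* {Γs = Γ ∷ _} (d ∷ ds) σ p = let p₁ , p₂ = ⊩ᴳ-⊕⁻ Γ p in
      soundness d σ p₁ , soundness* ds σ p₂

  -- Every type is realized.

  locations : List Loc
  locations = map (Inverse.from enumeration) (allFin size)

  ∈-locations : ∀ a → a ∈ locations
  ∈-locations a = ≡-subst (_∈ locations) (Inverse.strictlyInverseʳ enumeration a)
    (∈-map⁺ (Inverse.from enumeration) (∈-allFin (Inverse.to enumeration a)))

  -- Finiteness of the set of locations lets one number bound the demands of all stacks.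
  sup : (Loc → ℕ) → ℕ
  sup f = max 0 (map f locations)

  ≤-sup : ∀ f a → f a ≤ sup f
  ≤-sup f a = All.lookup (xs≤max 0 (map f locations)) (∈-map⁺ f (∈-locations a))

  pushAll : List Loc → Term n → Term n
  pushAll []       N = ⋆
  pushAll (a ∷ as) N = push N a (pushAll as N)

  rounds : ℕ → Term n → Term n
  rounds zero    N = ⋆
  rounds (suc k) N = pushAll locations N ⨾ rounds k N

  -- Run on any memory, filler (suc c) leaves at least c copies of filler c on
  -- top of every stack; for large c it realizes any given type.
  filler : ℕ → Term n
  filler zero    = ⋆
  filler (suc c) = rounds c (filler c)

  StartsWith : ℕ → Term n → List (Term n) → Set
  StartsWith k N = Prefix _≡_ (replicate k N)

  StartsWith-∷ : ∀ k {N : Term n} {s} → StartsWith k N s → StartsWith k N (N ∷ s)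
  StartsWith-∷ zero    p          = []
  StartsWith-∷ (suc k) (refl ∷ p) = refl ∷ StartsWith-∷ k p

  -- Only lower bounds on the copies on top are tracked, and these survive further pushes of `N`.
  -- Preservation at all locations carries the gain at the head of the list through the remaining
  -- pushes.
  pushAll-run : ∀ as (N : Term n) S → ∃ λ T → S , pushAll as N ⇓ T ×
                (∀ a k → StartsWith k N (S a) →
                   StartsWith k N (T a) × (a ∈ as → StartsWith (suc k) N (T a)))
  pushAll-run []       N S = S , (_ , unit (λ _ → refl)) , λ a k p → p , λ ()
  pushAll-run (b ∷ as) N S with T , (_ , r) , f ← pushAll-run as N (S · N at b) =
    T , (_ , push r) , λ a k p →
      proj₁ (f a k (kept k p)) ,
      λ { (here refl) → proj₁ (f b (suc k) (≡-subst (StartsWith (suc k) N) (sym (·-here S N b)) (refl ∷ p)))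
        ; (there a∈as) → proj₂ (f a k (kept k p)) a∈as }
    where
    kept : ∀ {a} k → StartsWith k N (S a) → StartsWith k N ((S · N at b) a)
    kept {a} k p with does (b ≟ a)
    ... | true  = StartsWith-∷ k p
    ... | false = p

  rounds-run : ∀ k (N : Term n) S → ∃ λ T → S , rounds k N ⇓ T ×
               (∀ a j → StartsWith j N (S a) → StartsWith (k + j) N (T a))
  rounds-run zero    N S = S , (_ , unit (λ _ → refl)) , λ a j p → p
  rounds-run (suc k) N S
    with T , (_ , r) , f ← pushAll-run locations N S
    with U , (_ , s) , g ← rounds-run k N T =
    U , (_ , seq r s) , λ a j p →
      ≡-subst (λ i → StartsWith i N (U a)) (+-suc k j)
        (g a (suc j) (proj₂ (f a j p) (∈-locations a)))

  mutual
    -- One number measures two demands: the successor in `boundˢ` counts the copies a stack must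
    -- hold, and the one in `bound` pays for passing from a filler to the fillers it pushes.
    bound : Type → ℕ
    bound (I ⇒ K) = suc (sup λ a → boundˢ (K a))

    boundᶜ : Collection → ℕ
    boundᶜ []      = 0
    boundᶜ (τ ∷ ι) = bound τ ⊔ boundᶜ ι

    boundˢ : List Collection → ℕ
    boundˢ []       = 0
    boundˢ (ι ∷ ιs) = boundᶜ ι ⊔ suc (boundˢ ιs)

  mutual
    filler-⊩ : ∀ τ {c} → bound τ ≤ c → filler {n} c ⊩ τ
    filler-⊩ (I ⇒ K) {suc c} (s≤s le) S _
      with T , r , f ← rounds-run c (filler c) S =
      T , r , λ a →
        let le′ = ≤-trans (≤-sup (λ a → boundˢ (K a)) a) le in
        -- The input memory is arbitrary, so the count starts at zero copies and `c` rounds bring it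
        -- to `c + 0`.
        StartsWith-⊩ˢ (K a) (c + 0) (≤-trans le′ (m≤m+n c 0)) le′ (f a 0 [])

    filler-⊩ᶜ : ∀ ι {c} → boundᶜ ι ≤ c → filler {n} c ⊩ᶜ ι
    filler-⊩ᶜ []      le = tt
    filler-⊩ᶜ (τ ∷ ι) le =
      filler-⊩ τ (m⊔n≤o⇒m≤o _ _ le) , filler-⊩ᶜ ι (m⊔n≤o⇒n≤o (bound τ) _ le)

    -- `k` counts the copies left and falls along the stack, while the rank `c` of the copied filler
    -- stays fixed; hence two separate bounds.
    StartsWith-⊩ˢ : ∀ ιs {c} k {s} → boundˢ ιs ≤ k → boundˢ ιs ≤ c →
                    StartsWith k (filler {n} c) s → s ⊩ˢ ιs
    StartsWith-⊩ˢ []       k       le le′ p = tt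
    StartsWith-⊩ˢ (ι ∷ ιs) zero    le le′ p = contradiction (m⊔n≤o⇒n≤o (boundᶜ ι) _ le) λ ()
    StartsWith-⊩ˢ (ι ∷ ιs) (suc k) le le′ (refl ∷ p) =
      filler-⊩ᶜ ι (m⊔n≤o⇒m≤o _ _ le′) ,
      StartsWith-⊩ˢ ιs k (s≤s⁻¹ (m⊔n≤o⇒n≤o (boundᶜ ι) _ le))
                         (≤-trans (n≤1+n _) (m⊔n≤o⇒n≤o (boundᶜ ι) _ le′)) p

  fillers-⊩ˢ : ∀ ιs → map (λ ι → filler {n} (boundᶜ ι)) ιs ⊩ˢ ιs
  fillers-⊩ˢ []       = tt
  fillers-⊩ˢ (ι ∷ ιs) = filler-⊩ᶜ ι ≤-refl , fillers-⊩ˢ ιs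

  WeaklyTypeable⇒MachineTerminating : {M : Term n} → WeaklyTypeable M → MachineTerminating M
  WeaklyTypeable⇒MachineTerminating (Γ , I ⇒ K , d)
    -- Closed fillers supply both the substitution for the context and the initial memory for the
    -- input type.
    with T , r , _ ← soundness d (λ x → filler {0} (boundᶜ (Γ x))) (λ x → filler-⊩ᶜ (Γ x) ≤-refl)
                       (λ a → map (λ ι → filler (boundᶜ ι)) (I a)) (λ a → fillers-⊩ˢ (I a)) =
    0 , _ , T , _ , r

  -- Typing of spine-normal forms.

  mutual
    ≈-refl : ∀ τ → τ ≈ τ
    ≈-refl (I ⇒ K) = (λ a → ≈ˢ-refl (I a)) ⇒ (λ a → ≈ˢ-refl (K a))

    ≈ˢ-refl : ∀ ιs → Pointwise _≈ᶜ_ ιs ιs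
    ≈ˢ-refl []       = []
    ≈ˢ-refl (ι ∷ ιs) = refl (≈*-refl ι) ∷ ≈ˢ-refl ιs

    ≈*-refl : ∀ ι → Pointwise _≈_ ι ι
    ≈*-refl []      = []
    ≈*-refl (τ ∷ ι) = ≈-refl τ ∷ ≈*-refl ι

  ⊢-resp-≗ : {Γ Δ : Context n} {M : Term n} {τ : Type} → Γ ≗ Δ → Γ ⊢ M ∶ τ → Δ ⊢ M ∶ τ
  ⊢-resp-≗ {Γ = Γ} e =
    conversion (λ x → ≡-subst (Γ x ≈ᶜ_) (e x) (refl (≈*-refl (Γ x)))) (≈-refl _)

  ⊢-resp-≗-domain : {Γ : Context n} {M : Term n} {I J K : Stacks Collection} →
                    I ≗ J → Γ ⊢ M ∶ I ⇒ K → Γ ⊢ M ∶ J ⇒ K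
  ⊢-resp-≗-domain {Γ = Γ} {I = I} {K = K} e =
    conversion (λ x → refl (≈*-refl (Γ x)))
               ((λ a → ≡-subst (Pointwise _≈ᶜ_ (I a)) (e a) (≈ˢ-refl (I a))) ⇒ (λ a → ≈ˢ-refl (K a)))

  -- Contexts are functions, so `Γ` agrees with its tail extended by its head only pointwise;
  -- conversion bridges the gap.
  abstraction′ : {Γ : Context (suc n)} {a : Loc} {M : Term (suc n)} {K L : Stacks Collection} →
                 Γ ⊢ M ∶ K ⇒ L → Vec.tail Γ ⊢ pop a M ∶ K · Vec.head Γ at a ⇒ L
  abstraction′ d = abstraction (⊢-resp-≗ (λ { zero → refl ; (suc x) → refl }) d)

  mutual
    Normal⇒typeable : {M : Term n} → Normal M → ∃ λ Γ → ∃₂ λ I K → Γ ⊢ M ∶ I ⇒ K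
    Normal⇒typeable (pop p) with Γ , I , K , d ← Normal⇒typeable p = _ , _ , K , abstraction′ d
    Normal⇒typeable (neutral p) with Γ , K , d ← Neutral⇒typeable p (λ _ → []) = Γ , _ , K , d

    -- The input type is arbitrary, as a `push` below has to prescribe it. A leading variable can
    -- take any input to whatever its continuation expects.
    Neutral⇒typeable : {M : Term n} → Neutral M → ∀ I → ∃₂ λ Γ K → Γ ⊢ M ∶ I ⇒ K
    Neutral⇒typeable var      I = _ , I , var
    Neutral⇒typeable (push {a = a} p) I with Γ , K , d ← Neutral⇒typeable p (I · [] at a) =
      -- The argument gets the empty collection, so it may be any term, normalizing or not.
      _ , K , application (collection []) d
    Neutral⇒typeable ⋆        I = _ , I , unit
    Neutral⇒typeable (seq p)  I with Γ , J , K , d ← Normal⇒typeable p =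
      _ , K , sequencing var d

  SpineNormalizing⇒MachineTerminating : {M : Term n} → SpineNormalizing M → MachineTerminating M
  SpineNormalizing⇒MachineTerminating (N , nf , ss)
    with Γ , I , K , d ← Normal⇒typeable (IsNormalForm⇒Normal nf) =
    MachineTerminating-expand ss (WeaklyTypeable⇒MachineTerminating (Γ , I ⇒ K , d))

  -- From terminating runs to typings, by closures.

  data Closure (m : ℕ) : Set where
    free    : Fin m → Closure m
    closure : Term n → (Fin n → Closure m) → Closure m

  ⟦_⟧ : Closure m → Term m
  ⟦ free y ⟧      = var y
  ⟦ closure M ρ ⟧ = subst (λ x → ⟦ ρ x ⟧) M

  ⟦⟧-term : (M : Term m) → ⟦ closure M free ⟧ ≡ M
  ⟦⟧-term = subst-var

  infix 4 _∈ᵗ_ _∈ˢ_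

  -- The typing of free variables is irrelevant: a machine never runs one.
  _∈ᵗ_ : Closure m → Type → Set
  free y      ∈ᵗ τ = ⊤
  closure M ρ ∈ᵗ τ = ∃ λ Γ → Γ ⊢ M ∶ τ × (∀ x → All (ρ x ∈ᵗ_) (Γ x))

  -- Unlike ⊩ˢ, this fixes the height of the stack: a push can only be typed
  -- if its argument gets a collection type.
  _∈ˢ_ : Stacks (Closure m) → Stacks Collection → Set
  S ∈ˢ I = ∀ a → Pointwise (λ c ι → All (c ∈ᵗ_) ι) (S a) (I a)

  ∈ˢ-push : {S : Stacks (Closure m)} {I : Stacks Collection} {c : Closure m} {ι : Collection} {a : Loc} →
            S ∈ˢ I → All (c ∈ᵗ_) ι → S · c at a ∈ˢ I · ι at a
  ∈ˢ-push {a = a} s p b with does (a ≟ b)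
  ... | true  = p ∷ s b
  ... | false = s b

  ∈ˢ-pop : {S : Stacks (Closure m)} {I : Stacks Collection} {c : Closure m} {a : Loc} →
           S · c at a ∈ˢ I →
           ∃ λ ι → I ≗ popAt a I · ι at a × All (c ∈ᵗ_) ι × S ∈ˢ popAt a I
  ∈ˢ-pop {S = S} {I} {c} {a} p
    with I a in eq | ≡-subst (λ s → Pointwise _ s (I a)) (·-here S c a) (p a)
  ... | ι ∷ ιs | q ∷ _ = ι , ·-popAt eq , q , rest
    where
    rest : S ∈ˢ popAt a I
    rest b with does (a ≟ b) | p b
    ... | false | pb = pb
    ... | true  | pb with _ ∷ _ ← I b | _ ∷ pb′ ← pb = pb′

  -- Each use of the argument brings its own context; their sum types the argument for all uses
  -- together.
  closure-collection : {N : Term n} {ρ : Fin n → Closure m} {ι : Collection} →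
                       All (closure N ρ ∈ᵗ_) ι → ∃ λ Γ → Γ ⊢ N ∶ᶜ ι × (∀ x → All (ρ x ∈ᵗ_) (Γ x))
  closure-collection {N = N} {ρ} ps = let Γs , ds , es = contexts ps in ⨁ Γs , collection ds , es
    where
    contexts : ∀ {ι} → All (closure N ρ ∈ᵗ_) ι →
               ∃ λ Γs → Pointwise (λ Γ τ → Γ ⊢ N ∶ τ) Γs ι × (∀ x → All (ρ x ∈ᵗ_) (⨁ Γs x))
    contexts []                = [] , [] , λ x → []
    contexts ((Γ , d , e) ∷ ps) with Γs , ds , es ← contexts ps =
      Γ ∷ Γs , d ∷ ds , λ x → ++⁺ (e x) (es x)

  map-· : (f : X → Y) (S : Stacks X) (x : X) (a : Loc) →
          map f ∘ (S · x at a) ≗ (map f ∘ S) · f x at a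
  map-· f S x a b with does (a ≟ b)
  ... | true  = refl
  ... | false = refl

  -- Lifts a pop observed on the decoded memory to the memory of closures.
  map-·⁻ : (f : X → Y) {S : Stacks X} {T : Stacks Y} {y : Y} {a : Loc} →
           map f ∘ S ≗ T · y at a →
           ∃ λ x → S ≗ popAt a S · x at a × f x ≡ y × map f ∘ popAt a S ≗ T
  map-·⁻ f {S} {T} {y} {a} e with S a in eq | ≡-trans (e a) (·-here T y a)
  ... | x ∷ s | e′ = x , S≗ , ∷-injectiveˡ e′ , T≗
    where
    S≗ = ·-popAt eq
    T≗ : map f ∘ popAt a S ≗ T
    T≗ = ·-injectiveˡ {a = a} λ b →
      ≡-trans (sym (map-· f (popAt a S) x a b)) (≡-trans (cong (map f) (sym (S≗ b))) (e b))

  ⟦⟧-∷ : (c : Closure m) (ρ : Fin n → Closure m) (M : Term (suc n)) →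
         ⟦ closure M (c Vec.∷ ρ) ⟧ ≡ subst (ext (λ x → ⟦ ρ x ⟧)) M [ ⟦ c ⟧ ]
  ⟦⟧-∷ c ρ M = ≡-trans (subst-cong (λ { zero → refl ; (suc x) → refl }) M) (sym (subst-ext-[] _ M _))

  ↪-All : (P : Fin n → Type → Set) {τ : Type} (x : Fin n) → P x τ →
          ∀ y → All (P y) ((x ↪ (τ ∷ [])) y)
  ↪-All P zero    p zero    = p ∷ []
  ↪-All P zero    p (suc y) = []
  ↪-All P (suc x) p zero    = []
  ↪-All P (suc x) p (suc y) = ↪-All (P ∘ suc) x p y

  -- The final closures are found before any type is chosen; types then flow from output to input.
  -- In a sequence, the second run thus fixes the intermediate type that the first must reach.
  Completed : Stacks (Closure m) → Closure m → Memory m → Set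
  Completed Ŝ c T = ∃ λ T̂ → map ⟦_⟧ ∘ T̂ ≗ T ×
    (∀ K → T̂ ∈ˢ K → ∃ λ I → Ŝ ∈ˢ I × c ∈ᵗ I ⇒ K)

  completeness : {S T : Memory m} {P : Term m} {i : ℕ} → S , P ⇓[ i ] T →
                 (c : Closure m) → ⟦ c ⟧ ≡ P → (Ŝ : Stacks (Closure m)) → map ⟦_⟧ ∘ Ŝ ≗ S →
                 Completed Ŝ c T
  -- No machine rule evaluates a variable.
  completeness () (free y) refl Ŝ e
  -- The run stays the same but the closure shrinks to `ρ x`: the recursion is lexicographic in run
  -- and closure.
  completeness r (closure (var x) ρ) eq Ŝ e
    with T̂ , f , back ← completeness r (ρ x) eq Ŝ e = T̂ , f , λ K t →
      let I , s , p = back K t in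
      I , s , x ↪ (_ ∷ []) , var , ↪-All (λ y τ → ρ y ∈ᵗ τ) x p
  completeness (pop f r) (closure (pop a M) ρ) refl Ŝ e
    with ĉ , g , refl , h ← map-·⁻ ⟦_⟧ {a = a} (λ b → ≡-trans (e b) (f b))
    with T̂ , j , back ← completeness r (closure M (ĉ Vec.∷ ρ)) (⟦⟧-∷ ĉ ρ M) (popAt a Ŝ) h = T̂ , j , λ K t →
      let I , s , Γ , d , p = back K t in
      -- The head of `Γ` lists the types at which the body used the popped closure, and becomes the
      -- collection demanded on top of stack `a`.
      I · Vec.head Γ at a ,
      (λ b → ≡-subst (λ s → Pointwise _ s _) (sym (g b)) (∈ˢ-push s (p zero) b)) ,
      Vec.tail Γ , abstraction′ d , λ x → p (suc x)
  completeness (push r) (closure (push N a M) ρ) refl Ŝ e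
    with T̂ , f , back ← completeness r (closure M ρ) refl (Ŝ · closure N ρ at a)
           (λ b → ≡-trans (map-· ⟦_⟧ Ŝ (closure N ρ) a b) (·-cong e b)) = T̂ , f , λ K t →
      let I , s , Δ , d , q = back K t
          ι , g , ps , s′ = ∈ˢ-pop {I = I} {a = a} s
          Γ , d′ , p = closure-collection ps in
      popAt a I , s′ , Γ ⊕ Δ , application d′ (⊢-resp-≗-domain g d) , λ x → ++⁺ (p x) (q x)
  completeness (unit f) (closure ⋆ ρ) refl Ŝ e =
    Ŝ , (λ a → ≡-trans (e a) (f a)) , λ K t → K , t , ∅ , unit , λ x → []
  completeness (seq r r′) (closure (N ⨾ M) ρ) refl Ŝ e
    with T̂ , f , back  ← completeness r (closure N ρ) refl Ŝ e
    with Û , g , back′ ← completeness r′ (closure M ρ) refl T̂ f = Û , g , λ L u →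
      let K , t , Δ , d′ , q = back′ L u
          I , s , Γ , d , p  = back K t in
      I , s , Γ ⊕ Δ , sequencing d d′ , λ x → ++⁺ (p x) (q x)

  ⟦⟧-terms : (s : List (Term m)) → map ⟦_⟧ (map (λ N → closure N free) s) ≡ s
  ⟦⟧-terms []      = refl
  ⟦⟧-terms (N ∷ s) = cong₂ _∷_ (⟦⟧-term N) (⟦⟧-terms s)

  ∈ˢ-untyped : (s : List (Closure m)) → Pointwise (λ c ι → All (c ∈ᵗ_) ι) s (map (const []) s)
  ∈ˢ-untyped []      = []
  ∈ˢ-untyped (c ∷ s) = [] ∷ ∈ˢ-untyped s

  MachineTerminating⇒WeaklyTypeable : {M : Term n} → MachineTerminating M → WeaklyTypeable M
  MachineTerminating⇒WeaklyTypeable {M = M} (_ , S , T , σ , _ , r)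
    -- Placing `σ` in the environment makes the resulting derivation type `M` itself and not its
    -- instance.
    with T̂ , _ , back ← completeness r (closure M (λ x → closure (σ x) free))
           (subst-cong (λ x → ⟦⟧-term (σ x)) M) (λ a → map (λ N → closure N free) (S a))
           (λ a → ⟦⟧-terms (S a))
    -- Empty collections type any final memory and start the backward pass.
    with I , _ , Γ , d , _ ← back (λ a → map (const []) (T̂ a)) (λ a → ∈ˢ-untyped (T̂ a)) =
    Γ , I ⇒ _ , d

theorem20 : (L : Locations) → let open FMC L in
    ∀ {n : ℕ} (M : Term n) →
    (WeaklyTypeable M ⇔ SpineNormalizing M) × (SpineNormalizing M ⇔ MachineTerminating M)
theorem20 L M =
  mk⇔ (MachineTerminating⇒SpineNormalizing ∘ WeaklyTypeable⇒MachineTerminating)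
      (MachineTerminating⇒WeaklyTypeable ∘ SpineNormalizing⇒MachineTerminating) ,
  mk⇔ SpineNormalizing⇒MachineTerminating MachineTerminating⇒SpineNormalizing
  where open WeakTyping L
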